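{- Let $p$ and $q$ be positive rational primes. Then: (1) $\mathcal{F}_p=\mathcal{F}_q$ if and only if $p=q$. (2) Given any prime $p$, there exist infinitely many PPI-polynomials $f$ that attain the value $p$ at some integer but such that no translate $f(x-b)$, $b\in\mathbb{Z}$, is in $\mathcal{F}_p$. (3) The Bouniakowsky Hypothesis (BH) holds if and only if every PPI-polynomial $f$ belongs to $\mathcal{F}_p$ for some prime $p$.
   Context: A polynomial in $\mathbb{Z}[x]$ is positive if its leading coefficient is positive; a non-constant polynomial in $\mathbb{Z}[x]$ is proper if the gcd of its values at all integers is $1$; a PPI-polynomial is a (non-constant) positive, proper polynomial irreducible in $\mathbb{Z}[x]$. Every positive polynomial $g$ has a unique base-$x$ representation $\sum_{i=0}^m b_i(x)x^i$ with digits $b_i(x)\in\{0,1,2,\dots\}\cup\{x-1,x-2,\dots\}$, $b_m(x)\ne0$; $\mathrm{MB}(g)$ is the least positive integer $a$ such that all its digits lie in $\{0,\dots,a-1\}\cup\{x-1,\dots,x-a\}$. For a prime $p$, $\mathcal{F}_p$ is the set consisting of the constant polynomial $p$, the cyclotomic polynomial $\Phi_p(x)=x^{p-1}+\cdots+x+1$, and every PPI-polynomial $g(x)\in\mathbb{Z}[x]$ such that $g(b)=p$ for some integer $b\ge\mathrm{MB}(g)$. Bouniakowsky Hypothesis (BH): for every proper irreducible polynomial $f(x)\in\mathbb{Z}[x]$ with positive leading coefficient, $f(n)$ takes prime values for infinitely many positive integers $n$. -}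

module Defs where

open import Algebra.Bundles.Raw using (RawSemiring)
import Algebra.Definitions.RawSemiring as SemiringDefinitions
open import Data.Integer.Base as ℤ using (ℤ; +_; -[1+_]; 0ℤ; 1ℤ)
open import Data.Integer.Divisibility using (_∣_)
open import Data.List.Base using (List; []; _∷_; foldr; map; replicate)
import Data.List.Membership.Setoid as Membership
open import Data.Nat.Base as ℕ using (ℕ; zero; suc)
open import Data.Nat.Primality using (Prime)
open import Data.Product.Base using (_×_; ∃; ∃-syntax)
open import Data.Sum.Base using (_⊎_)
open import Data.Vec.Base as Vec using (Vec)
open import Data.Vec.Relation.Unary.All using (All)
open import Level using (0ℓ; _⊔_)
open import Relation.Binary.Bundles using (Setoid)
open import Relation.Binary.PropositionalEquality
  using (_≡_; _≢_; refl; sym; trans; setoid)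
open import Relation.Nullary.Negation using (¬_)
open import Relation.Unary using (Pred)

-- Elements of ℤ[x] are coefficient lists, constant term first. Trailing zeros
-- are allowed, so equality of polynomials is _≈_ and not _≡_.

Poly : Set
Poly = List ℤ

coeff : Poly → ℕ → ℤ
coeff []      _       = 0ℤ
coeff (a ∷ f) zero    = a
coeff (a ∷ f) (suc n) = coeff f n

infix 4 _≈_
_≈_ : Poly → Poly → Set
f ≈ g = ∀ n → coeff f n ≡ coeff g n

polySetoid : Setoid 0ℓ 0ℓ
polySetoid = record
  { Carrier       = Poly
  ; _≈_           = _≈_
  ; isEquivalence = record
    { refl  = λ _ → refl
    ; sym   = λ e n → sym (e n)
    ; trans = λ e e′ n → trans (e n) (e′ n)
    }
  }

const : ℤ → Poly
const a = a ∷ []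

infixl 6 _⊕_
_⊕_ : Poly → Poly → Poly
[]      ⊕ g       = g
(a ∷ f) ⊕ []      = a ∷ f
(a ∷ f) ⊕ (b ∷ g) = a ℤ.+ b ∷ f ⊕ g

infixl 7 _⊗_
_⊗_ : Poly → Poly → Poly
[]      ⊗ g = []
(a ∷ f) ⊗ g = map (a ℤ.*_) g ⊕ (0ℤ ∷ f ⊗ g)

eval : Poly → ℤ → ℤ
eval f n = foldr (λ a v → a ℤ.+ n ℤ.* v) 0ℤ f

compose : Poly → Poly → Poly
compose f g = foldr (λ a h → const a ⊕ g ⊗ h) [] f

-- translate f b is f(x - b).
translate : Poly → ℤ → Poly
translate f b = compose f (ℤ.- b ∷ 1ℤ ∷ [])

polyRawSemiring : RawSemiring 0ℓ 0ℓ
polyRawSemiring = record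
  { Carrier = Poly
  ; _≈_     = _≈_
  ; _+_     = _⊕_
  ; _*_     = _⊗_
  ; 0#      = []
  ; 1#      = const 1ℤ
  }

open SemiringDefinitions polyRawSemiring using (Irreducible)

Positive : Pred Poly 0ℓ
Positive f =
  ∃[ n ] 0ℤ ℤ.< coeff f n × (∀ m → n ℕ.< m → coeff f m ≡ 0ℤ)

Constant : Pred Poly 0ℓ
Constant f = ∃[ a ] f ≈ const a

IsGCDOfValues : Poly → ℤ → Set
IsGCDOfValues f d =
  (∀ n → d ∣ eval f n) × (∀ e → (∀ n → e ∣ eval f n) → e ∣ d)

Proper : Pred Poly 0ℓ
Proper f = ¬ Constant f × IsGCDOfValues f 1ℤ

record PPI (f : Poly) : Set where
  field
    positive    : Positive f
    proper      : Proper f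
    irreducible : Irreducible f

data Digit : Set where
  low  : ℕ → Digit
  high : ℕ → Digit

-- The offset in high makes the two families disjoint: high k is x - (k + 1).
digitPoly : Digit → Poly
digitPoly (low k)  = const (+ k)
digitPoly (high k) = -[1+ k ] ∷ 1ℤ ∷ []

-- d ∈ {0, …, a - 1} ∪ {x - 1, …, x - a}
DigitBelow : ℕ → Pred Digit 0ℓ
DigitBelow a (low k)  = k ℕ.< a
DigitBelow a (high k) = k ℕ.< a

-- The sum of bᵢ(x) xⁱ, in Horner form: 0ℤ ∷ h is x · h.
fromDigits : ∀ {n} → Vec Digit n → Poly
fromDigits Vec.[]       = []
fromDigits (b Vec.∷ bs) = digitPoly b ⊕ (0ℤ ∷ fromDigits bs)

IsBaseXRepresentation : Poly → ∀ {m} → Vec Digit (suc m) → Set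
IsBaseXRepresentation g bs = Vec.last bs ≢ low 0 × g ≈ fromDigits bs

record IsLeastDigitBound {n} (bs : Vec Digit n) (a : ℕ) : Set where
  field
    positive : 0 ℕ.< a
    bound    : All (DigitBelow a) bs
    least    : ∀ c → 0 ℕ.< c → All (DigitBelow c) bs → a ℕ.≤ c

-- IsMB g a means MB(g) = a. It is a relation because MB is defined only for
-- positive g; the base-x representation of such a g is unique.
IsMB : Poly → ℕ → Set
IsMB g a = ∃[ m ] ∃ λ (bs : Vec Digit (suc m)) →
  IsBaseXRepresentation g bs × IsLeastDigitBound bs a

infix 4 _≥MB_
_≥MB_ : ℤ → Poly → Set
b ≥MB g = ∃[ a ] IsMB g a × + a ℤ.≤ b

-- x ^ (p - 1) + ⋯ + x + 1, which is the cyclotomic polynomial for p prime.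
Φ : ℕ → Poly
Φ p = replicate p 1ℤ

𝓕 : ℕ → Pred Poly 0ℓ
𝓕 p g =
    g ≈ const (+ p)
  ⊎ g ≈ Φ p
  ⊎ (PPI g × ∃[ b ] b ≥MB g × eval g b ≡ + p)

-- No finite list exhausts P.
InfinitelyMany : ∀ {a ℓ p} (S : Setoid a ℓ) →
                 Pred (Setoid.Carrier S) p → Set (a ⊔ ℓ ⊔ p)
InfinitelyMany S P = ∀ xs → ∃[ x ] P x × x ∉ xs
  where open Membership S using (_∉_)

BouniakowskyHypothesis : Set
BouniakowskyHypothesis = ∀ f → Positive f → Proper f → Irreducible f →
  InfinitelyMany (setoid ℕ) λ n →
    0 ℕ.< n × ∃[ p ] Prime p × eval f (+ n) ≡ + p

{-# OPTIONS --safe #-}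
module Submission where

-- Since 𝓕 p contains the constant p but no other prime constant, it
-- determines p. For (2) take f = x^(2k+2) + p, irreducible by Eisenstein: if a
-- translate g = f(x - c) has g(b) = p then c = b, and g(0) = b^(2k+2) + p
-- exceeds every constant term of a base-x digit allowed by MB(g) ≤ b. For (3),
-- prime values of f at arbitrarily large n include one at some n ≥ MB(f), while
-- membership of the translates f(x + k) yields prime values beyond every k,
-- because the argument at which such a translate takes its prime value is
-- positive. Polynomial identities are checked at all integers.

open import Defs
import Algebra.Definitions.RawMagma as RawMagma
import Algebra.Definitions.RawSemiring as SemiringDefinitions
import Algebra.Properties.AbelianGroup as AbelianGroupProperties
open import Data.Integer.Base as ℤ using (ℤ; +_; -[1+_]; +[1+_]; 0ℤ; 1ℤ; -1ℤ; ∣_∣; +≤+; +<+; -<+)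
import Data.Integer.Divisibility as Unsigned
open import Data.Integer.Divisibility.Signed as ℤ∣ using (∣ᵤ⇒∣; ∣⇒∣ᵤ)
import Data.Integer.Properties as ℤ
open import Data.Integer.Tactic.RingSolver using (solve-∀)
open import Data.List.Base using ([]; _∷_; _++_; length; map; replicate; upTo)
open import Data.List.Extrema.Nat using (max; xs≤max)
open import Data.List.Membership.Propositional.Properties using (∈-upTo⁺)
import Data.List.Relation.Unary.All as ListAll
import Data.List.Relation.Unary.All.Properties as ListAll
import Data.List.Relation.Unary.Any as Any
open import Data.Nat.Base as ℕ using (ℕ; zero; suc; z≤n; s≤s; z<s; s<s; s<s⁻¹; _⊔_)
import Data.Nat.Divisibility as ℕ∣
open import Data.Nat.Induction using (<-rec)
open import Data.Nat.Primality using (Prime; prime⇒nonZero; prime⇒nonTrivial; euclidsLemma)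
import Data.Nat.Properties as ℕ
open import Data.Product.Base using (_×_; _,_; ∃; ∃-syntax; proj₁; proj₂)
open import Data.Sum.Base as Sum using (_⊎_; inj₁; inj₂; [_,_]′)
open import Data.Vec.Base as Vec using (Vec; []; _∷_)
open import Data.Vec.Relation.Unary.All as VecAll using ([]; _∷_)
open import Function.Base using (_∘_; id; case_of_)
open import Function.Bundles using (_⇔_; mk⇔)
open import Relation.Binary.PropositionalEquality
  using (_≡_; _≢_; refl; sym; trans; cong; cong₂; subst; setoid; module ≡-Reasoning)
open import Relation.Nullary.Decidable.Core using (yes; no)
open import Relation.Nullary.Negation using (¬_; contradiction)
open import Relation.Unary using (_≐_; _∈_)
open import Relation.Unary.Properties using (≐-refl)
open AbelianGroupProperties ℤ.+-0-abelianGroup using (∙-cancelˡ)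
open SemiringDefinitions polyRawSemiring using (Irreducible) renaming (_∣_ to _∣ₚ_)

-- Degree at most `n`, phrased through coefficients because lists may end in zeros.
ZeroAbove : Poly → ℕ → Set
ZeroAbove f n = ∀ m → n ℕ.< m → coeff f m ≡ 0ℤ

-- Coefficients

coeff-⊕ : ∀ f g n → coeff (f ⊕ g) n ≡ coeff f n ℤ.+ coeff g n
coeff-⊕ []      g       n       = sym (ℤ.+-identityˡ _)
coeff-⊕ (a ∷ f) []      n       = sym (ℤ.+-identityʳ _)
coeff-⊕ (a ∷ f) (b ∷ g) zero    = refl
coeff-⊕ (a ∷ f) (b ∷ g) (suc n) = coeff-⊕ f g n

coeff-scale : ∀ a f n → coeff (map (a ℤ.*_) f) n ≡ a ℤ.* coeff f n
coeff-scale a []      n       = sym (ℤ.*-zeroʳ a)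
coeff-scale a (b ∷ f) zero    = refl
coeff-scale a (b ∷ f) (suc n) = coeff-scale a f n

coeff-∷-⊗ : ∀ a f g n →
  coeff ((a ∷ f) ⊗ g) n ≡ a ℤ.* coeff g n ℤ.+ coeff (0ℤ ∷ f ⊗ g) n
coeff-∷-⊗ a f g n = trans (coeff-⊕ (map (a ℤ.*_) g) (0ℤ ∷ f ⊗ g) n)
  (cong (ℤ._+ coeff (0ℤ ∷ f ⊗ g) n) (coeff-scale a g n))

coeff-zero-const : ∀ n → coeff (const 0ℤ) n ≡ 0ℤ
coeff-zero-const zero    = refl
coeff-zero-const (suc n) = refl

coeff-const-⊗ : ∀ a f n → coeff (const a ⊗ f) n ≡ a ℤ.* coeff f n
coeff-const-⊗ a f n = begin
  coeff (const a ⊗ f) n                         ≡⟨ coeff-∷-⊗ a [] f n ⟩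
  a ℤ.* coeff f n ℤ.+ coeff (const 0ℤ) n        ≡⟨ cong (λ z → a ℤ.* coeff f n ℤ.+ z) (coeff-zero-const n) ⟩
  a ℤ.* coeff f n ℤ.+ 0ℤ                        ≡⟨ ℤ.+-identityʳ _ ⟩
  a ℤ.* coeff f n                               ∎
  where open ≡-Reasoning

zero-⊗ : ∀ f g → (∀ n → coeff f n ≡ 0ℤ) → ∀ n → coeff (f ⊗ g) n ≡ 0ℤ
zero-⊗ []      g f≈0 n = refl
zero-⊗ (a ∷ f) g f≈0 n
  rewrite coeff-∷-⊗ a f g n | f≈0 0 | ℤ.+-identityˡ (coeff (0ℤ ∷ f ⊗ g) n)
  with n
... | zero  = refl
... | suc n = zero-⊗ f g (f≈0 ∘ suc) n

-- In every other product of coefficients contributing to index `m ℕ.+ n`, one index exceeds its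
-- bound.
coeff-⊗-top : ∀ f g m n → ZeroAbove f m → ZeroAbove g n →
  coeff (f ⊗ g) (m ℕ.+ n) ≡ coeff f m ℤ.* coeff g n
coeff-⊗-top [] g m n f↑ g↑ = refl
coeff-⊗-top (a ∷ f) g zero n f↑ g↑
  rewrite coeff-∷-⊗ a f g n with n
... | zero  = ℤ.+-identityʳ _
... | suc n rewrite zero-⊗ f g (λ k → f↑ (suc k) z<s) n = ℤ.+-identityʳ _
coeff-⊗-top (a ∷ f) g (suc m) n f↑ g↑
  rewrite coeff-∷-⊗ a f g (suc m ℕ.+ n)
        | g↑ (suc m ℕ.+ n) (s≤s (ℕ.m≤n+m n m))
        | ℤ.*-zeroʳ a
        | ℤ.+-identityˡ (coeff (f ⊗ g) (m ℕ.+ n))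
  = coeff-⊗-top f g m n (λ k m<k → f↑ (suc k) (s<s m<k)) g↑

coeff-beyond-length : ∀ f n → length f ℕ.≤ n → coeff f n ≡ 0ℤ
coeff-beyond-length []      n       _         = refl
coeff-beyond-length (a ∷ f) (suc n) (s≤s len) = coeff-beyond-length f n len

-- Decided from the far end of the list, so that trailing zeros are skipped: the head is the leading
-- coefficient only if the whole tail vanishes.
degree : ∀ f → (∀ n → coeff f n ≡ 0ℤ) ⊎
               (∃[ n ] coeff f n ≢ 0ℤ × ZeroAbove f n)
degree [] = inj₁ λ _ → refl
degree (a ∷ f) with degree f
... | inj₂ (n , fₙ≢0 , f↑) =
  inj₂ (suc n , fₙ≢0 , λ { (suc m) (s≤s n<m) → f↑ m n<m })
... | inj₁ f≈0 with a ℤ.≟ 0ℤ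
...   | yes a≡0 = inj₁ λ { zero → a≡0 ; (suc n) → f≈0 n }
...   | no  a≢0 = inj₂ (0 , a≢0 , λ { (suc m) _ → f≈0 m })

-- Evaluation

eval-⊕ : ∀ f g x → eval (f ⊕ g) x ≡ eval f x ℤ.+ eval g x
eval-⊕ []      g       x = sym (ℤ.+-identityˡ _)
eval-⊕ (a ∷ f) []      x = sym (ℤ.+-identityʳ _)
eval-⊕ (a ∷ f) (b ∷ g) x rewrite eval-⊕ f g x =
  identity a b x (eval f x) (eval g x)
  where
  identity : ∀ a b x u v →
    a ℤ.+ b ℤ.+ x ℤ.* (u ℤ.+ v) ≡ (a ℤ.+ x ℤ.* u) ℤ.+ (b ℤ.+ x ℤ.* v)
  identity = solve-∀

eval-scale : ∀ a f x → eval (map (a ℤ.*_) f) x ≡ a ℤ.* eval f x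
eval-scale a []      x = sym (ℤ.*-zeroʳ a)
eval-scale a (b ∷ f) x rewrite eval-scale a f x = identity a b x (eval f x)
  where
  identity : ∀ a b x u → a ℤ.* b ℤ.+ x ℤ.* (a ℤ.* u) ≡ a ℤ.* (b ℤ.+ x ℤ.* u)
  identity = solve-∀

eval-⊗ : ∀ f g x → eval (f ⊗ g) x ≡ eval f x ℤ.* eval g x
eval-⊗ []      g x = refl
eval-⊗ (a ∷ f) g x
  rewrite eval-⊕ (map (a ℤ.*_) g) (0ℤ ∷ f ⊗ g) x
        | eval-scale a g x
        | eval-⊗ f g x
        | ℤ.+-identityˡ (x ℤ.* (eval f x ℤ.* eval g x))
  = identity a x (eval f x) (eval g x)
  where
  identity : ∀ a x u v → a ℤ.* v ℤ.+ x ℤ.* (u ℤ.* v) ≡ (a ℤ.+ x ℤ.* u) ℤ.* v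
  identity = solve-∀

eval-const : ∀ a x → eval (const a) x ≡ a
eval-const a x = trans (cong (λ z → a ℤ.+ z) (ℤ.*-zeroʳ x)) (ℤ.+-identityʳ a)

eval-compose : ∀ f g x → eval (compose f g) x ≡ eval f (eval g x)
eval-compose []      g x = refl
eval-compose (a ∷ f) g x
  rewrite eval-⊕ (const a) (g ⊗ compose f g) x
        | eval-const a x
        | eval-⊗ g (compose f g) x
        | eval-compose f g x
  = refl

eval-translate : ∀ f b x → eval (translate f b) x ≡ eval f (x ℤ.- b)
eval-translate f b x =
  trans (eval-compose f (ℤ.- b ∷ 1ℤ ∷ []) x) (cong (eval f) argument)
  where
  argument : ℤ.- b ℤ.+ x ℤ.* (1ℤ ℤ.+ x ℤ.* 0ℤ) ≡ x ℤ.- b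
  argument rewrite ℤ.*-zeroʳ x | ℤ.*-identityʳ x = ℤ.+-comm (ℤ.- b) x

eval-zero : ∀ f x → (∀ n → coeff f n ≡ 0ℤ) → eval f x ≡ 0ℤ
eval-zero []      x f≈0 = refl
eval-zero (a ∷ f) x f≈0
  rewrite f≈0 0 | eval-zero f x (f≈0 ∘ suc) | ℤ.*-zeroʳ x = refl

eval-cong : ∀ f g → f ≈ g → ∀ x → eval f x ≡ eval g x
eval-cong []      g     f≈g x = sym (eval-zero g x (sym ∘ f≈g))
eval-cong (a ∷ f) []    f≈g x = eval-zero (a ∷ f) x f≈g
eval-cong (a ∷ f) (b ∷ g) f≈g x =
  cong₂ (λ u v → u ℤ.+ x ℤ.* v) (f≈g 0) (eval-cong f g (f≈g ∘ suc) x)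

eval-at-0 : ∀ f → eval f 0ℤ ≡ coeff f 0
eval-at-0 []      = refl
eval-at-0 (a ∷ f) = ℤ.+-identityʳ a

-- The constant coefficient is divisible by every positive integer, hence by
-- its own absolute value plus one.
vanishing⇒zero : ∀ f → (∀ n → eval f +[1+ n ] ≡ 0ℤ) → ∀ k → coeff f k ≡ 0ℤ
vanishing⇒zero []      _  k = refl
vanishing⇒zero (a ∷ f) f0 = λ { zero → a≡0 ; (suc k) → vanishing⇒zero f tail0 k }
  where
  x∣a : ∀ n → +[1+ n ] ℤ∣.∣ a
  x∣a n = ℤ∣.∣m+n∣n⇒∣m {+[1+ n ]} {a}
    (subst (+[1+ n ] ℤ∣.∣_) (sym (f0 n)) (ℤ∣.divides 0ℤ refl))
    (ℤ∣.∣m⇒∣m*n (eval f +[1+ n ]) ℤ∣.∣-refl)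

  a≡0 : a ≡ 0ℤ
  a≡0 with ∣ a ∣ in eq
  ... | zero  = ℤ.∣i∣≡0⇒i≡0 eq
  ... | suc m = contradiction
    (subst (suc (suc m) ℕ∣.∣_) eq (∣⇒∣ᵤ (x∣a (suc m))))
    (ℕ∣.>⇒∤ ℕ.≤-refl)

  -- With `a` gone the value is x times that of the tail, and x cancels because it is positive.
  -- Testing only positive points keeps the recursion going.
  tail0 : ∀ n → eval f +[1+ n ] ≡ 0ℤ
  tail0 n with ℤ.i*j≡0⇒i≡0∨j≡0 +[1+ n ]
    (trans (sym (ℤ.+-identityˡ _))
      (trans (cong (ℤ._+ +[1+ n ] ℤ.* eval f +[1+ n ]) (sym a≡0)) (f0 n)))
  ... | inj₂ eq = eq

-- The difference vanishes at every integer, hence coefficientwise. This reduces the polynomial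
-- identities below to identities between integers.
eval-injective : ∀ f g → (∀ x → eval f x ≡ eval g x) → f ≈ g
eval-injective f g f≡g n = ℤ.i-j≡0⇒i≡j (coeff f n) (coeff g n) (begin
  coeff f n ℤ.- coeff g n                       ≡⟨ cong (λ z → coeff f n ℤ.+ z) (ℤ.-1*i≡-i (coeff g n)) ⟨
  coeff f n ℤ.+ -1ℤ ℤ.* coeff g n               ≡⟨ cong (λ z → coeff f n ℤ.+ z) (coeff-scale -1ℤ g n) ⟨
  coeff f n ℤ.+ coeff (map (-1ℤ ℤ.*_) g) n      ≡⟨ coeff-⊕ f (map (-1ℤ ℤ.*_) g) n ⟨
  coeff (f ⊕ map (-1ℤ ℤ.*_) g) n                ≡⟨ vanishing⇒zero (f ⊕ map (-1ℤ ℤ.*_) g) (difference ∘ +[1+_]) n ⟩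
  0ℤ                                            ∎)
  where
  open ≡-Reasoning
  difference : ∀ x → eval (f ⊕ map (-1ℤ ℤ.*_) g) x ≡ 0ℤ
  difference x = begin
    eval (f ⊕ map (-1ℤ ℤ.*_) g) x              ≡⟨ eval-⊕ f (map (-1ℤ ℤ.*_) g) x ⟩
    eval f x ℤ.+ eval (map (-1ℤ ℤ.*_) g) x     ≡⟨ cong₂ ℤ._+_ (f≡g x) (eval-scale -1ℤ g x) ⟩
    eval g x ℤ.+ -1ℤ ℤ.* eval g x              ≡⟨ cong (λ z → eval g x ℤ.+ z) (ℤ.-1*i≡-i (eval g x)) ⟩
    eval g x ℤ.- eval g x                      ≡⟨ ℤ.+-inverseʳ (eval g x) ⟩
    0ℤ                                         ∎

⊗-comm : ∀ f g → f ⊗ g ≈ g ⊗ f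
⊗-comm f g = eval-injective (f ⊗ g) (g ⊗ f) λ x → begin
  eval (f ⊗ g) x          ≡⟨ eval-⊗ f g x ⟩
  eval f x ℤ.* eval g x   ≡⟨ ℤ.*-comm (eval f x) (eval g x) ⟩
  eval g x ℤ.* eval f x   ≡⟨ eval-⊗ g f x ⟨
  eval (g ⊗ f) x          ∎
  where open ≡-Reasoning

-- Translation

-- In Horner form the translate is a + (x - b) h, and its coefficient at n + 1 is -b times that of h
-- at n + 1 plus that of h at n. The first summand drops out once h is known to vanish above n, so
-- both claims are proved together.
translate-top : ∀ f b n → ZeroAbove f n →
  coeff (translate f b) n ≡ coeff f n × ZeroAbove (translate f b) n
translate-top [] b n f↑ = refl , λ _ _ → refl
translate-top (a ∷ f) b = top
  where
  h = translate f b
  X = ℤ.- b ∷ 1ℤ ∷ []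

  -- For the degree bound 0: the tail is then a zero polynomial, though perhaps a nonempty list, and
  -- its translate has to vanish too.
  head : ZeroAbove f 0 → coeff f 0 ≡ 0ℤ → ∀ n → coeff h n ≡ 0ℤ
  head f↑ f₀≡0 zero    = trans (proj₁ (translate-top f b 0 f↑)) f₀≡0
  head f↑ f₀≡0 (suc n) = proj₂ (translate-top f b 0 f↑) (suc n) z<s

  coeff-0 : coeff (const a ⊕ X ⊗ h) 0 ≡ a ℤ.+ ℤ.- b ℤ.* coeff h 0
  coeff-0
    rewrite coeff-⊕ (const a) (X ⊗ h) 0 | coeff-∷-⊗ (ℤ.- b) (1ℤ ∷ []) h 0
    = cong (λ z → a ℤ.+ z) (ℤ.+-identityʳ _)

  coeff-suc : ∀ n → coeff (const a ⊕ X ⊗ h) (suc n) ≡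
                    ℤ.- b ℤ.* coeff h (suc n) ℤ.+ coeff h n
  coeff-suc n
    rewrite coeff-⊕ (const a) (X ⊗ h) (suc n)
          | coeff-∷-⊗ (ℤ.- b) (1ℤ ∷ []) h (suc n)
          | coeff-const-⊗ 1ℤ h n
          | ℤ.*-identityˡ (coeff h n)
    = ℤ.+-identityˡ _

  next : ∀ n {c} → coeff h (suc n) ≡ 0ℤ → coeff h n ≡ c →
         coeff (const a ⊕ X ⊗ h) (suc n) ≡ c
  next n hₙ₊₁≡0 refl
    rewrite coeff-suc n | hₙ₊₁≡0 | ℤ.*-zeroʳ (ℤ.- b) = ℤ.+-identityˡ _

  top : ∀ n → ZeroAbove (a ∷ f) n →
        coeff (const a ⊕ X ⊗ h) n ≡ coeff (a ∷ f) n ×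
        ZeroAbove (const a ⊕ X ⊗ h) n
  top zero f↑ =
      trans coeff-0 (trans (cong (λ z → a ℤ.+ ℤ.- b ℤ.* z) (h≈0 0))
        (trans (cong (λ z → a ℤ.+ z) (ℤ.*-zeroʳ (ℤ.- b))) (ℤ.+-identityʳ a)))
    , λ { (suc m) _ → next m (h≈0 (suc m)) (h≈0 m) }
    where
    h≈0 = head (λ m _ → f↑ (suc m) z<s) (f↑ 1 z<s)
  top (suc n) f↑ =
      next n (h↑ (suc n) ℕ.≤-refl) hₙ
    , λ { (suc m) (s≤s n<m) → next m (h↑ (suc m) (ℕ.m≤n⇒m≤1+n n<m)) (h↑ m n<m) }
    where
    ih = translate-top f b n (λ m n<m → f↑ (suc m) (s<s n<m))
    hₙ = proj₁ ih
    h↑ = proj₂ ih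

translate-cong : ∀ f g b → f ≈ g → translate f b ≈ translate g b
translate-cong f g b f≈g = eval-injective (translate f b) (translate g b) λ x →
  trans (eval-translate f b x)
    (trans (eval-cong f g f≈g (x ℤ.- b)) (sym (eval-translate g b x)))

translate-⊗ : ∀ f g b → translate (f ⊗ g) b ≈ translate f b ⊗ translate g b
translate-⊗ f g b = eval-injective (translate (f ⊗ g) b) (translate f b ⊗ translate g b) λ x → begin
  eval (translate (f ⊗ g) b) x                       ≡⟨ eval-translate (f ⊗ g) b x ⟩
  eval (f ⊗ g) (x ℤ.- b)                             ≡⟨ eval-⊗ f g (x ℤ.- b) ⟩
  eval f (x ℤ.- b) ℤ.* eval g (x ℤ.- b)              ≡⟨ cong₂ ℤ._*_ (eval-translate f b x) (eval-translate g b x) ⟨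
  eval (translate f b) x ℤ.* eval (translate g b) x  ≡⟨ eval-⊗ (translate f b) (translate g b) x ⟨
  eval (translate f b ⊗ translate g b) x             ∎
  where open ≡-Reasoning

[x+b]-b≡x : ∀ x b → (x ℤ.+ b) ℤ.- b ≡ x
[x+b]-b≡x = solve-∀

eval-translate-shifted : ∀ f b x → eval (translate f b) (x ℤ.+ b) ≡ eval f x
eval-translate-shifted f b x =
  trans (eval-translate f b (x ℤ.+ b)) (cong (eval f) ([x+b]-b≡x x b))

translate-inverse : ∀ f b → translate (translate f b) (ℤ.- b) ≈ f
translate-inverse f b = eval-injective (translate (translate f b) (ℤ.- b)) f λ x → begin
  eval (translate (translate f b) (ℤ.- b)) x  ≡⟨ eval-translate (translate f b) (ℤ.- b) x ⟩
  eval (translate f b) (x ℤ.- ℤ.- b)          ≡⟨ cong (λ z → eval (translate f b) (x ℤ.+ z)) (ℤ.neg-involutive b) ⟩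
  eval (translate f b) (x ℤ.+ b)              ≡⟨ eval-translate-shifted f b x ⟩
  eval f x                                    ∎
  where open ≡-Reasoning

unit-cong : ∀ f g → f ≈ g → f ∣ₚ const 1ℤ → g ∣ₚ const 1ℤ
unit-cong f g f≈g (h RawMagma., hf≈1) = h RawMagma., eval-injective (h ⊗ g) (const 1ℤ) λ x → begin
  eval (h ⊗ g) x          ≡⟨ eval-⊗ h g x ⟩
  eval h x ℤ.* eval g x   ≡⟨ cong (λ z → eval h x ℤ.* z) (eval-cong f g f≈g x) ⟨
  eval h x ℤ.* eval f x   ≡⟨ eval-⊗ h f x ⟨
  eval (h ⊗ f) x          ≡⟨ eval-cong (h ⊗ f) (const 1ℤ) hf≈1 x ⟩
  eval (const 1ℤ) x       ∎
  where open ≡-Reasoning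

translate-unit : ∀ f b → f ∣ₚ const 1ℤ → translate f b ∣ₚ const 1ℤ
translate-unit f b (h RawMagma., hf≈1) = translate h b RawMagma., λ n →
  trans (sym (translate-⊗ h f b n))
    (trans (translate-cong (h ⊗ f) (const 1ℤ) b hf≈1 n) (translate-1 n))
  where
  translate-1 : translate (const 1ℤ) b ≈ const 1ℤ
  translate-1 = eval-injective (translate (const 1ℤ) b) (const 1ℤ) λ x →
    trans (eval-translate (const 1ℤ) b x)
      (trans (eval-const 1ℤ (x ℤ.- b)) (sym (eval-const 1ℤ x)))

untranslate-unit : ∀ f b → translate f b ∣ₚ const 1ℤ → f ∣ₚ const 1ℤ
untranslate-unit f b u =
  unit-cong (translate (translate f b) (ℤ.- b)) f (translate-inverse f b)
    (translate-unit (translate f b) (ℤ.- b) u)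

-- The inverse translation carries a factorisation of the translate back to one of `f`, and
-- translation preserves units in both directions.
translate-irreducible : ∀ f b → Irreducible f → Irreducible (translate f b)
translate-irreducible f b irr = record
  { p∤1      = p∤1 ∘ untranslate-unit f b
  ; split-∣1 = λ {x} {y} f≈xy →
      Sum.map (untranslate-unit x (ℤ.- b)) (untranslate-unit y (ℤ.- b))
        (split-∣1 λ n → trans (sym (translate-inverse f b n))
          (trans (translate-cong (translate f b) (x ⊗ y) (ℤ.- b) f≈xy n)
            (translate-⊗ x y (ℤ.- b) n)))
  }
  where open SemiringDefinitions.Irreducible irr

-- Translation only reindexes the values at the integers, so their common divisors stay the same.
translate-proper : ∀ f b → Proper f → Proper (translate f b)
translate-proper f b (nonconstant , _ , greatest) =
    (λ (a , f≈a) → nonconstant (a , eval-injective f (const a) λ x →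
      trans (sym (eval-translate-shifted f b x))
        (trans (eval-cong (translate f b) (const a) f≈a (x ℤ.+ b))
          (trans (eval-const a (x ℤ.+ b)) (sym (eval-const a x))))))
  , (λ _ → ℕ∣.1∣ _)
  , λ e e∣ → greatest e λ x →
      subst (e Unsigned.∣_) (eval-translate-shifted f b x) (e∣ (x ℤ.+ b))

translate-PPI : ∀ f b → PPI f → PPI (translate f b)
translate-PPI f b ppi = record
  { positive    = let n , fₙ>0 , f↑ = positive
                      fₙ , h↑ = translate-top f b n f↑
                  in n , subst (0ℤ ℤ.<_) (sym fₙ) fₙ>0 , h↑
  ; proper      = translate-proper f b proper
  ; irreducible = translate-irreducible f b irreducible
  }
  where open PPI ppi

-- Eisenstein's criterion

coeff-⊗-∣ : ∀ d f g k → (∀ {j} → j ℕ.≤ k → d ℤ∣.∣ coeff g j) →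
            d ℤ∣.∣ coeff (f ⊗ g) k
coeff-⊗-∣ d []      g k d∣g = ℤ∣.divides 0ℤ refl
coeff-⊗-∣ d (a ∷ f) g k d∣g =
  subst (d ℤ∣.∣_) (sym (coeff-∷-⊗ a f g k))
    (ℤ∣.∣m∣n⇒∣m+n (ℤ∣.∣n⇒∣m*n a (d∣g ℕ.≤-refl)) (shifted k d∣g))
  where
  shifted : ∀ k → (∀ {j} → j ℕ.≤ k → d ℤ∣.∣ coeff g j) →
            d ℤ∣.∣ coeff (0ℤ ∷ f ⊗ g) k
  shifted zero    _   = ℤ∣.divides 0ℤ refl
  shifted (suc k) d∣g = coeff-⊗-∣ d f g k (d∣g ∘ ℕ.m≤n⇒m≤1+n)

-- All terms of the convolution except the first contain a coefficient of `g` of index below `k`;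
-- `r` collects them.
coeff-⊗-mod : ∀ d f g k → (∀ {j} → j ℕ.< k → d ℤ∣.∣ coeff g j) →
              ∃[ r ] d ℤ∣.∣ r × coeff (f ⊗ g) k ≡ coeff f 0 ℤ.* coeff g k ℤ.+ r
coeff-⊗-mod d []      g k d∣g = 0ℤ , ℤ∣.divides 0ℤ refl , refl
coeff-⊗-mod d (a ∷ f) g k d∣g = _ , shifted k d∣g , coeff-∷-⊗ a f g k
  where
  shifted : ∀ k → (∀ {j} → j ℕ.< k → d ℤ∣.∣ coeff g j) →
            d ℤ∣.∣ coeff (0ℤ ∷ f ⊗ g) k
  shifted zero    _   = ℤ∣.divides 0ℤ refl
  shifted (suc k) d∣g = coeff-⊗-∣ d f g k (d∣g ∘ s≤s)

coeff-⊗-0 : ∀ f g → coeff (f ⊗ g) 0 ≡ coeff f 0 ℤ.* coeff g 0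
coeff-⊗-0 []      g = refl
coeff-⊗-0 (a ∷ f) g = trans (coeff-∷-⊗ a f g 0) (ℤ.+-identityʳ _)

module _ {p} (pr : Prime p) where

  euclidsLemmaℤ : ∀ i j → + p ℤ∣.∣ i ℤ.* j → + p ℤ∣.∣ i ⊎ + p ℤ∣.∣ j
  euclidsLemmaℤ i j p∣ij = Sum.map ∣ᵤ⇒∣ ∣ᵤ⇒∣
    (euclidsLemma ∣ i ∣ ∣ j ∣ pr (subst (p ℕ∣.∣_) (ℤ.abs-* i j) (∣⇒∣ᵤ p∣ij)))

  prime∤1 : ¬ + p ℤ∣.∣ 1ℤ
  prime∤1 p∣1 = ℕ∣.>⇒∤ (ℕ.nonTrivial⇒n>1 p {{prime⇒nonTrivial pr}}) (∣⇒∣ᵤ p∣1)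

  module _ (f : Poly) (d : ℕ)
           (f-monic : coeff f (suc d) ≡ 1ℤ) (f↑ : ZeroAbove f (suc d))
           (p∣f : ∀ {k} → k ℕ.< suc d → + p ℤ∣.∣ coeff f k)
           (p²∤f₀ : ¬ + p ℤ.* + p ℤ∣.∣ coeff f 0) where

    -- Modulo p, the product is coeff x 0 times y up to the first coefficient
    -- of y prime to p, so this coefficient comes no earlier than the top
    -- degree of f. Hence y has the degree of f and x is constant.
    factor-unit : ∀ x y → f ≈ x ⊗ y → ¬ + p ℤ∣.∣ coeff x 0 → x ∣ₚ const 1ℤ
    factor-unit x y f≈xy p∤x₀ with degree x | degree y
    ... | inj₁ x≈0 | _ =
      contradiction (subst (+ p ℤ∣.∣_) (sym (x≈0 0)) (ℤ∣.divides 0ℤ refl)) p∤x₀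
    ... | inj₂ (e , xₑ≢0 , x↑) | ydegree = conclude ydegree
      where
      p∣y : ∀ k → k ℕ.< suc d → + p ℤ∣.∣ coeff y k
      p∣y = <-rec _ λ k below k<1+d →
        let r , p∣r , eq = coeff-⊗-mod (+ p) x y k
              (λ j<k → below j<k (ℕ.<-trans j<k k<1+d))
        in [ (λ p∣x₀ → contradiction p∣x₀ p∤x₀) , id ]′
             (euclidsLemmaℤ (coeff x 0) (coeff y k)
               (ℤ∣.∣m+n∣n⇒∣m {m = coeff x 0 ℤ.* coeff y k}
                 (subst (+ p ℤ∣.∣_) (trans (f≈xy k) eq) (p∣f k<1+d)) p∣r))

      -- Otherwise the congruence in degree `suc d` would make the leading coefficient 1 of `f`
      -- divisible by `p`.
      y-top≢0 : coeff y (suc d) ≢ 0ℤ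
      y-top≢0 y≡0 =
        let r , p∣r , eq = coeff-⊗-mod (+ p) x y (suc d) (λ {j} → p∣y j)
            1≡r : 1ℤ ≡ r
            1≡r = begin
              1ℤ                                       ≡⟨ f-monic ⟨
              coeff f (suc d)                          ≡⟨ f≈xy (suc d) ⟩
              coeff (x ⊗ y) (suc d)                    ≡⟨ eq ⟩
              coeff x 0 ℤ.* coeff y (suc d) ℤ.+ r      ≡⟨ cong (λ z → coeff x 0 ℤ.* z ℤ.+ r) y≡0 ⟩
              coeff x 0 ℤ.* 0ℤ ℤ.+ r                   ≡⟨ cong (ℤ._+ r) (ℤ.*-zeroʳ (coeff x 0)) ⟩
              0ℤ ℤ.+ r                                 ≡⟨ ℤ.+-identityˡ r ⟩
              r                                        ∎
        in prime∤1 (subst (+ p ℤ∣.∣_) (sym 1≡r) p∣r)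
        where open ≡-Reasoning

      conclude : ((∀ n → coeff y n ≡ 0ℤ) ⊎ (∃[ n ] coeff y n ≢ 0ℤ × ZeroAbove y n)) →
                 x ∣ₚ const 1ℤ
      conclude (inj₁ y≈0) = contradiction (y≈0 (suc d)) y-top≢0
      -- The degrees `e` and `n` add up to `suc d`, and `n` is at least `suc d`, so `x` is the
      -- constant `coeff x e`. Its product with the leading coefficient of `y` is that of `f`, which
      -- is 1.
      conclude (inj₂ (n , yₙ≢0 , y↑)) = const (coeff y n) RawMagma., inverse
        where
        1+d≤n : suc d ℕ.≤ n
        1+d≤n = ℕ.≮⇒≥ (y-top≢0 ∘ y↑ (suc d))

        top : coeff f (e ℕ.+ n) ≡ coeff x e ℤ.* coeff y n
        top = trans (f≈xy (e ℕ.+ n)) (coeff-⊗-top x y e n x↑ y↑)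

        e+n≤1+d : e ℕ.+ n ℕ.≤ suc d
        e+n≤1+d = ℕ.≮⇒≥ λ 1+d<e+n →
          [ xₑ≢0 , yₙ≢0 ]′ (ℤ.i*j≡0⇒i≡0∨j≡0 (coeff x e)
            (trans (sym top) (f↑ (e ℕ.+ n) 1+d<e+n)))

        e≡0 : e ≡ 0
        e≡0 = ℕ.n≤0⇒n≡0 (ℕ.+-cancelʳ-≤ n e 0 (ℕ.≤-trans e+n≤1+d 1+d≤n))

        e+n≡1+d : e ℕ.+ n ≡ suc d
        e+n≡1+d = ℕ.≤-antisym e+n≤1+d (ℕ.≤-trans 1+d≤n (ℕ.m≤n+m n e))

        inverse : const (coeff y n) ⊗ x ≈ const 1ℤ
        inverse zero = begin
          coeff (const (coeff y n) ⊗ x) 0   ≡⟨ coeff-const-⊗ (coeff y n) x 0 ⟩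
          coeff y n ℤ.* coeff x 0           ≡⟨ cong (λ i → coeff y n ℤ.* coeff x i) e≡0 ⟨
          coeff y n ℤ.* coeff x e           ≡⟨ ℤ.*-comm (coeff y n) (coeff x e) ⟩
          coeff x e ℤ.* coeff y n           ≡⟨ top ⟨
          coeff f (e ℕ.+ n)                 ≡⟨ cong (coeff f) e+n≡1+d ⟩
          coeff f (suc d)                   ≡⟨ f-monic ⟩
          1ℤ                                ∎
          where open ≡-Reasoning
        inverse (suc k) =
          trans (coeff-const-⊗ (coeff y n) x (suc k))
            (trans (cong (λ z → coeff y n ℤ.* z) (x↑ (suc k) (subst (ℕ._< suc k) (sym e≡0) z<s)))
              (ℤ.*-zeroʳ (coeff y n)))

    -- The square of `p` does not divide the product of the constant coefficients of two factors, so
    -- `p` fails to divide one of them, and `factor-unit` makes that factor a unit.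
    eisenstein : Irreducible f
    eisenstein = record { p∤1 = nonunit ; split-∣1 = λ {x} {y} → split x y }
      where
      p∣f₀ : + p ℤ∣.∣ coeff f 0
      p∣f₀ = p∣f z<s

      nonunit : ¬ f ∣ₚ const 1ℤ
      nonunit (h RawMagma., hf≈1) = prime∤1
        (subst (+ p ℤ∣.∣_) (trans (sym (coeff-⊗-0 h f)) (hf≈1 0))
          (ℤ∣.∣n⇒∣m*n (coeff h 0) p∣f₀))

      split : ∀ x y → f ≈ x ⊗ y → x ∣ₚ const 1ℤ ⊎ y ∣ₚ const 1ℤ
      split x y f≈xy with + p ℤ∣.∣? coeff x 0 | + p ℤ∣.∣? coeff y 0
      ... | no p∤x₀ | _ = inj₁ (factor-unit x y f≈xy p∤x₀)
      ... | yes _   | no p∤y₀ =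
        inj₂ (factor-unit y x (λ n → trans (f≈xy n) (⊗-comm x y n)) p∤y₀)
      ... | yes p∣x₀ | yes p∣y₀ = contradiction
        (subst (+ p ℤ.* + p ℤ∣.∣_) (sym (trans (f≈xy 0) (coeff-⊗-0 x y)))
          (ℤ∣.∣-trans (ℤ∣.*-monoʳ-∣ (+ p) p∣y₀) (ℤ∣.*-monoˡ-∣ (coeff y 0) p∣x₀)))
        p²∤f₀

-- Base-x representations

HasRepresentation : Poly → Set
HasRepresentation f =
  ∃[ m ] ∃ λ (bs : Vec Digit (suc m)) → IsBaseXRepresentation f bs

last-∷ : ∀ {m d} b (bs : Vec Digit (suc m)) → Vec.last bs ≢ d → Vec.last (b ∷ bs) ≢ d
last-∷ b (_ ∷ _) last≢ = last≢

low-∷ : ∀ k f → HasRepresentation f → HasRepresentation (+ k ∷ f)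
low-∷ k f (m , bs , last≢ , f≈bs) =
  suc m , low k ∷ bs , last-∷ (low k) bs last≢ ,
  λ { zero → sym (ℤ.+-identityʳ _) ; (suc n) → f≈bs n }

-- The digit `high k` is x - (k + 1), so it supplies the constant -(k + 1) together with a surplus
-- x, which is paid for by taking 1 from the next coefficient.
high-∷ : ∀ k c f → HasRepresentation (-1ℤ ℤ.+ c ∷ f) → HasRepresentation (-[1+ k ] ∷ c ∷ f)
high-∷ k c f (m , bs , last≢ , f≈bs) =
  suc m , high k ∷ bs , last-∷ (high k) bs last≢ ,
  λ { zero → refl ; (suc n) → trans (carry n) (sym (coeff-⊕ (const 1ℤ) (fromDigits bs) n)) }
  where
  1+[-1+c]≡c : ∀ c → 1ℤ ℤ.+ (-1ℤ ℤ.+ c) ≡ c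
  1+[-1+c]≡c = solve-∀

  carry : ∀ n → coeff (c ∷ f) n ≡ coeff (const 1ℤ) n ℤ.+ coeff (fromDigits bs) n
  carry zero    = trans (sym (1+[-1+c]≡c c)) (cong (λ z → 1ℤ ℤ.+ z) (f≈bs 0))
  carry (suc n) = trans (f≈bs (suc n)) (sym (ℤ.+-identityˡ _))

-- Digits are split off from the constant term upwards: a nonnegative coefficient is a low digit, a
-- negative one a high digit with a borrow. The borrow reaches the leading coefficient only in
-- degree 1, which therefore has cases of its own.
base-x-representation : ∀ n f → 0ℤ ℤ.< coeff f n → ZeroAbove f n → HasRepresentation f
base-x-representation n [] (+<+ ()) _
base-x-representation zero (+ zero ∷ f) (+<+ ()) _
base-x-representation zero (+[1+ c ] ∷ f) _ f↑ =
  0 , low (suc c) ∷ [] , (λ ()) ,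
  λ { zero → sym (ℤ.+-identityʳ _) ; (suc m) → f↑ (suc m) z<s }
base-x-representation (suc n) (+ k ∷ f) fₙ>0 f↑ =
  low-∷ k f (base-x-representation n f fₙ>0 (λ m → f↑ (suc m) ∘ s<s))
base-x-representation (suc n) (-[1+ k ] ∷ []) (+<+ ()) _
base-x-representation (suc zero) (-[1+ k ] ∷ + zero ∷ f) (+<+ ()) _
-- The borrow uses up the leading coefficient 1, so `high k` is the last digit. A larger leading
-- coefficient stays positive after the borrow and gives one more digit.
base-x-representation (suc zero) (-[1+ k ] ∷ + 1 ∷ f) _ f↑ =
  0 , high k ∷ [] , (λ ()) ,
  λ { zero → refl ; (suc zero) → refl ; (suc (suc m)) → f↑ (suc (suc m)) (s<s z<s) }
base-x-representation (suc zero) (-[1+ k ] ∷ +[1+ suc c ] ∷ f) _ f↑ =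
  high-∷ k +[1+ suc c ] f (base-x-representation zero (+[1+ c ] ∷ f) (+<+ z<s)
    λ { (suc m) _ → f↑ (suc (suc m)) (s<s z<s) })
base-x-representation (suc (suc n)) (-[1+ k ] ∷ c ∷ f) fₙ>0 f↑ =
  high-∷ k c f (base-x-representation (suc n) (-1ℤ ℤ.+ c ∷ f) fₙ>0
    λ { (suc m) n<m → f↑ (suc (suc m)) (s<s n<m) })

digitBound : Digit → ℕ
digitBound (low k)  = suc k
digitBound (high k) = suc k

below-bound : ∀ {a} d → digitBound d ℕ.≤ a → DigitBelow a d
below-bound (low k)  k<a = k<a
below-bound (high k) k<a = k<a

bound-least : ∀ {a} d → DigitBelow a d → digitBound d ℕ.≤ a
bound-least (low k)  k<a = k<a
bound-least (high k) k<a = k<a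

least-digit-bound : ∀ {n} (bs : Vec Digit n) → ∃ (IsLeastDigitBound bs)
-- The default is 1 and not 0 because a bound must be positive.
least-digit-bound [] = 1 , record { positive = z<s ; bound = [] ; least = λ _ 0<c _ → 0<c }
least-digit-bound (b ∷ bs) = digitBound b ⊔ a , record
  { positive = ℕ.<-≤-trans positive (ℕ.m≤n⊔m (digitBound b) a)
  ; bound    = below-bound b (ℕ.m≤m⊔n (digitBound b) a)
             ∷ VecAll.map (λ {d} d<a → below-bound d
                 (ℕ.≤-trans (bound-least d d<a) (ℕ.m≤n⊔m (digitBound b) a))) bound
  ; least    = λ { c 0<c (b<c ∷ bs<c) → ℕ.⊔-lub (bound-least b b<c) (least c 0<c bs<c) }
  }
  where
  a = proj₁ (least-digit-bound bs)
  open IsLeastDigitBound (proj₂ (least-digit-bound bs))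

MB-exists : ∀ f → Positive f → ∃ (IsMB f)
MB-exists f (n , fₙ>0 , f↑) =
  let m , bs , rep = base-x-representation n f fₙ>0 f↑
      a , least = least-digit-bound bs
  in a , m , bs , rep , least

-- MB is at least 1 by definition. The successor form allows matching on `b`.
≥MB⇒positive : ∀ {b f} → b ≥MB f → ∃[ n ] b ≡ +[1+ n ]
≥MB⇒positive {+[1+ n ]} _ = n , refl
≥MB⇒positive {+ zero} (_ , (_ , _ , _ , least) , +≤+ a≤0) =
  contradiction (IsLeastDigitBound.positive least) (ℕ.≤⇒≯ a≤0)

-- The lowest digit alone determines the constant coefficient: `low k` gives k, which is below MB,
-- and `high k` gives a negative number.
constant-coeff<≥MB : ∀ {b} f → b ≥MB f → coeff f 0 ℤ.< b
constant-coeff<≥MB {b} f (a , (_ , d ∷ bs , (_ , f≈bs) , least) , a≤b) =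
  subst (ℤ._< b) (sym (f≈bs 0)) (ℤ.<-≤-trans (digit d (VecAll.head bound)) a≤b)
  where
  open IsLeastDigitBound least
  digit : ∀ d → DigitBelow a d → coeff (digitPoly d ⊕ (0ℤ ∷ fromDigits bs)) 0 ℤ.< + a
  digit (low k)  k<a = subst (ℤ._< + a) (sym (ℤ.+-identityʳ (+ k))) (+<+ k<a)
  digit (high k) k<a = -<+

-- Values of the cyclotomic polynomial at 0 and 1

eval-Φ-0 : ∀ n .{{_ : ℕ.NonZero n}} → eval (Φ n) 0ℤ ≡ 1ℤ
eval-Φ-0 (suc n) = refl

eval-Φ-1 : ∀ n → eval (Φ n) 1ℤ ≡ + n
eval-Φ-1 zero    = refl
eval-Φ-1 (suc n) =
  cong (λ z → 1ℤ ℤ.+ z) (trans (ℤ.*-identityˡ (eval (Φ n) 1ℤ)) (eval-Φ-1 n))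

-- The polynomials x^(2k + 2) + p

monomial : ℕ → Poly
monomial n = replicate n 0ℤ ++ const 1ℤ

coeff-monomial-top : ∀ n → coeff (monomial n) n ≡ 1ℤ
coeff-monomial-top zero    = refl
coeff-monomial-top (suc n) = coeff-monomial-top n

coeff-monomial-below : ∀ {n k} → k ℕ.< n → coeff (monomial n) k ≡ 0ℤ
coeff-monomial-below {suc n} {zero}  _   = refl
coeff-monomial-below {suc n} {suc k} k<n = coeff-monomial-below (s<s⁻¹ k<n)

coeff-monomial-above : ∀ {n k} → n ℕ.< k → coeff (monomial n) k ≡ 0ℤ
coeff-monomial-above {zero}  {suc k} _   = refl
coeff-monomial-above {suc n} {suc k} n<k = coeff-monomial-above (s<s⁻¹ n<k)

eval-monomial : ∀ n x → eval (monomial n) x ≡ x ℤ.^ n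
eval-monomial zero    x = eval-const 1ℤ x
eval-monomial (suc n) x =
  trans (ℤ.+-identityˡ _) (cong (λ z → x ℤ.* z) (eval-monomial n x))

i^2≡∣i∣*∣i∣ : ∀ i → i ℤ.^ 2 ≡ + (∣ i ∣ ℕ.* ∣ i ∣)
i^2≡∣i∣*∣i∣ i rewrite ℤ.*-identityʳ i with i
... | + n      = sym (ℤ.pos-* n n)
... | -[1+ n ] = refl

n≤n*n : ∀ n → n ℕ.≤ n ℕ.* n
n≤n*n zero    = z≤n
n≤n*n (suc n) = ℕ.m≤m*n (suc n) (suc n)

∣i∣≤∣i^1+n∣ : ∀ i n → ∣ i ∣ ℕ.≤ ∣ i ℤ.^ suc n ∣
∣i∣≤∣i^1+n∣ i n with i ℤ.≟ 0ℤ
... | yes refl = z≤n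
... | no i≢0   = subst (∣ i ∣ ℕ.≤_) (sym (ℤ.abs-* i (i ℤ.^ n)))
  (ℕ.m≤m*n ∣ i ∣ ∣ i ℤ.^ n ∣
    {{ℕ.≢-nonZero (i≢0 ∘ ℤ.i^n≡0⇒i≡0 i n ∘ ℤ.∣i∣≡0⇒i≡0)}})

module _ {p} (pr : Prime p) (k : ℕ) where

  private instance
    p≢0 = prime⇒nonZero pr

  -- The exponent is even so that negative arguments also give values of at least `p`. The monomial
  -- has degree 2k + 1 because the head `+ p` shifts it by one.
  binomial : Poly
  binomial = + p ∷ monomial (suc (k ℕ.* 2))

  eval-binomial : ∀ x → eval binomial x ≡ + p ℤ.+ x ℤ.^ (suc k ℕ.* 2)
  eval-binomial x = cong (λ z → + p ℤ.+ x ℤ.* z) (eval-monomial (suc (k ℕ.* 2)) x)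

  eval-binomial-0 : eval binomial 0ℤ ≡ + p
  eval-binomial-0 = eval-at-0 binomial

  eval-binomial-root : ∀ x → eval binomial x ≡ + p → x ≡ 0ℤ
  eval-binomial-root x eq = ℤ.i^n≡0⇒i≡0 x (suc k ℕ.* 2)
    (∙-cancelˡ (+ p) _ 0ℤ (begin
      + p ℤ.+ x ℤ.^ (suc k ℕ.* 2)   ≡⟨ eval-binomial x ⟨
      eval binomial x                ≡⟨ eq ⟩
      + p                           ≡⟨ ℤ.+-identityʳ (+ p) ⟨
      + p ℤ.+ 0ℤ                    ∎))
    where open ≡-Reasoning

  -- The power of `x` is the square of `x ℤ.^ suc k`, and a natural number is at most its square.
  eval-binomial-≥ : ∀ x → + p ℤ.+ + ∣ x ∣ ℤ.≤ eval binomial x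
  eval-binomial-≥ x = begin
    + p ℤ.+ + ∣ x ∣                   ≤⟨ ℤ.+-monoʳ-≤ (+ p) (+≤+ (ℕ.≤-trans (∣i∣≤∣i^1+n∣ x k) (n≤n*n c))) ⟩
    + p ℤ.+ + (c ℕ.* c)               ≡⟨ cong (λ z → + p ℤ.+ z) (i^2≡∣i∣*∣i∣ (x ℤ.^ suc k)) ⟨
    + p ℤ.+ (x ℤ.^ suc k) ℤ.^ 2       ≡⟨ cong (λ z → + p ℤ.+ z) (ℤ.^-*-assoc x (suc k) 2) ⟩
    + p ℤ.+ x ℤ.^ (suc k ℕ.* 2)       ≡⟨ eval-binomial x ⟨
    eval binomial x                    ∎
    where
    open ℤ.≤-Reasoning
    c = ∣ x ℤ.^ suc k ∣

  binomial-PPI : PPI binomial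
  binomial-PPI = record
    { positive    = 2 ℕ.+ k ℕ.* 2 , subst (0ℤ ℤ.<_) (sym (coeff-monomial-top (suc (k ℕ.* 2)))) (+<+ z<s) , binomial↑
    ; proper      =
        (λ (a , eq) → case trans (sym (coeff-monomial-top (suc (k ℕ.* 2)))) (eq (2 ℕ.+ k ℕ.* 2)) of λ ())
      , (λ _ → ℕ∣.1∣ _)
      -- The values at 0 and 1 are p and p + 1, so a common divisor of all values divides 1.
      , λ e e∣ → ∣⇒∣ᵤ (ℤ∣.∣m+n∣m⇒∣n {m = + p} {1ℤ}
          (subst (e ℤ∣.∣_) eval-binomial-1 (∣ᵤ⇒∣ (e∣ 1ℤ)))
          (subst (e ℤ∣.∣_) eval-binomial-0 (∣ᵤ⇒∣ (e∣ 0ℤ))))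
    ; irreducible = eisenstein pr binomial (suc (k ℕ.* 2)) (coeff-monomial-top (suc (k ℕ.* 2))) binomial↑ p∣ p²∤p
    }
    where
    binomial↑ : ZeroAbove binomial (2 ℕ.+ k ℕ.* 2)
    binomial↑ (suc m) n<m = coeff-monomial-above (s<s⁻¹ n<m)

    eval-binomial-1 : eval binomial 1ℤ ≡ + p ℤ.+ 1ℤ
    eval-binomial-1 = trans (eval-binomial 1ℤ) (cong (λ z → + p ℤ.+ z) (ℤ.^-zeroˡ (suc k ℕ.* 2)))

    p∣ : ∀ {j} → j ℕ.< 2 ℕ.+ k ℕ.* 2 → + p ℤ∣.∣ coeff binomial j
    p∣ {zero}  _   = ℤ∣.∣-refl
    p∣ {suc j} j<n = ℤ∣.divides 0ℤ (coeff-monomial-below (s<s⁻¹ j<n))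

    p²∤p : ¬ + p ℤ.* + p ℤ∣.∣ + p
    p²∤p p²∣p = prime∤1 pr (ℤ∣.*-cancelˡ-∣ (+ p)
      (subst (+ p ℤ.* + p ℤ∣.∣_) (sym (ℤ.*-identityʳ (+ p))) p²∣p))

  -- A translate g of the binomial f takes the value p only at the point b by
  -- which it is translated, and then g(0) = f(-b) ≥ p + b is too large to be a
  -- base-x digit below b.
  translate-binomial∉𝓕 : ∀ b → ¬ translate binomial b ∈ 𝓕 p
  translate-binomial∉𝓕 b = λ
    { (inj₁ g≈p) →
        -- If the translate were the constant p, the binomial would take the value p at 1, although
        -- it does so only at 0.
        case eval-binomial-root 1ℤ (trans (sym (eval-translate-shifted binomial b 1ℤ))
               (trans (eval-cong g (const (+ p)) g≈p (1ℤ ℤ.+ b)) (eval-const (+ p) (1ℤ ℤ.+ b))))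
        of λ ()
    ; (inj₂ (inj₁ g≈Φ)) → cyclotomic g≈Φ
    ; (inj₂ (inj₂ (_ , n , n≥MB , gₙ≡p))) → digits n n≥MB gₙ≡p
    }
    where
    g = translate binomial b

    root : ∀ n → eval g n ≡ + p → n ≡ b
    root n gₙ≡p = ℤ.i-j≡0⇒i≡j n b
      (eval-binomial-root (n ℤ.- b) (trans (sym (eval-translate binomial b n)) gₙ≡p))

    p+∣b∣≤g₀ : + p ℤ.+ + ∣ b ∣ ℤ.≤ eval g 0ℤ
    p+∣b∣≤g₀ = begin
      + p ℤ.+ + ∣ b ∣            ≡⟨ cong (λ n → + p ℤ.+ + n) (trans (cong ∣_∣ (ℤ.+-identityˡ (ℤ.- b))) (ℤ.∣-i∣≡∣i∣ b)) ⟨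
      + p ℤ.+ + ∣ 0ℤ ℤ.- b ∣     ≤⟨ eval-binomial-≥ (0ℤ ℤ.- b) ⟩
      eval binomial (0ℤ ℤ.- b)    ≡⟨ eval-translate binomial b 0ℤ ⟨
      eval g 0ℤ                  ∎
      where open ℤ.≤-Reasoning

    -- `Φ p` takes the value p at 1, which forces b = 1. Then g(0) is at least p + 1, whereas `Φ p`
    -- has the value 1 at 0.
    cyclotomic : ¬ g ≈ Φ p
    cyclotomic g≈Φ with refl ← root 1ℤ (trans (eval-cong g (Φ p) g≈Φ 1ℤ) (eval-Φ-1 p)) =
      contradiction (ℤ.drop‿+≤+ p+1≤1) (ℕ.<⇒≱ (ℕ.m<n+m 1 (ℕ.>-nonZero⁻¹ p)))
      where
      p+1≤1 : + p ℤ.+ 1ℤ ℤ.≤ 1ℤ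
      p+1≤1 = subst (+ p ℤ.+ 1ℤ ℤ.≤_) (trans (eval-cong g (Φ p) g≈Φ 0ℤ) (eval-Φ-0 p)) p+∣b∣≤g₀

    digits : ∀ n → n ≥MB g → eval g n ≢ + p
    digits n n≥MB gₙ≡p
      with refl ← root n gₙ≡p | c , refl ← ≥MB⇒positive {f = g} n≥MB =
      ℤ.<-irrefl refl (begin-strict
        b                    ≤⟨ +≤+ (ℕ.m≤n+m ∣ b ∣ p) ⟩
        + p ℤ.+ + ∣ b ∣      ≤⟨ p+∣b∣≤g₀ ⟩
        eval g 0ℤ            ≡⟨ eval-at-0 g ⟩
        coeff g 0            <⟨ constant-coeff<≥MB g n≥MB ⟩
        b                    ∎)
      where open ℤ.≤-Reasoning

-- Infinitude and unboundedness

-- With `k` at least the length of every list in `fs`, the polynomial `f k` has a nonzero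
-- coefficient where all members of `fs` have 0.
unbounded-degrees : ∀ {ℓ} {P : Poly → Set ℓ} (f : ℕ → Poly) →
  (∀ k → P (f k)) → (∀ k → ∃[ n ] k ℕ.≤ n × coeff (f k) n ≢ 0ℤ) →
  InfinitelyMany polySetoid P
unbounded-degrees f Pf nonzero fs =
  let k = max 0 (map length fs)
      n , k≤n , fₙ≢0 = nonzero k
      lengths≤k = ListAll.map⁻ (xs≤max 0 (map length fs))
  in f k , Pf k , λ f∈fs →
      let len≤k , f≈g = ListAll.lookupAny lengths≤k f∈fs
      in fₙ≢0 (trans (f≈g n) (coeff-beyond-length (Any.lookup f∈fs) n (ℕ.≤-trans len≤k k≤n)))

unbounded⇒infinitelyMany : ∀ {ℓ} {P : ℕ → Set ℓ} → (∀ k → ∃[ n ] k ℕ.< n × P n) →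
  InfinitelyMany (setoid ℕ) P
unbounded⇒infinitelyMany P↑ ns =
  let n , max<n , Pn = P↑ (max 0 ns)
  in n , Pn , λ n∈ns → ℕ.<⇒≱ max<n (ListAll.lookup (xs≤max 0 ns) n∈ns)

-- A witness outside the list 0, ..., k - 1 is at least `k`.
infinitelyMany⇒unbounded : ∀ {ℓ} {P : ℕ → Set ℓ} → InfinitelyMany (setoid ℕ) P →
  ∀ k → ∃[ n ] k ℕ.≤ n × P n
infinitelyMany⇒unbounded infinite k =
  let n , Pn , n∉ = infinite (upTo k)
  in n , ℕ.≮⇒≥ (n∉ ∘ ∈-upTo⁺) , Pn

-- Membership in `𝓕 p` and prime values

PPI≉const : ∀ {f} a → PPI f → ¬ f ≈ const a
PPI≉const a ppi f≈a = proj₁ (PPI.proper ppi) (a , f≈a)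

-- PPI-polynomials are non-constant, and so is `Φ q` for q at least 2, as its coefficient at x is 1.
-- `Φ 0` and `Φ 1` are the constants 0 and 1, which again equal q.
const∈𝓕⇒≡ : ∀ p q → const (+ p) ∈ 𝓕 q → p ≡ q
const∈𝓕⇒≡ p q             (inj₁ p≈q)              = ℤ.+-injective (p≈q 0)
const∈𝓕⇒≡ p zero          (inj₂ (inj₁ p≈Φ))       = ℤ.+-injective (p≈Φ 0)
const∈𝓕⇒≡ p (suc zero)    (inj₂ (inj₁ p≈Φ))       = ℤ.+-injective (p≈Φ 0)
const∈𝓕⇒≡ p (suc (suc q)) (inj₂ (inj₁ p≈Φ))       with () ← p≈Φ 1
const∈𝓕⇒≡ p q             (inj₂ (inj₂ (ppi , _))) =
  contradiction (λ _ → refl) (PPI≉const (+ p) ppi)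

BH⇒member : BouniakowskyHypothesis → ∀ f → PPI f → ∃[ p ] Prime p × f ∈ 𝓕 p
BH⇒member BH f ppi =
  let a , mb = MB-exists f positive
      n , a≤n , 0<n , p , pr , fₙ≡p =
        infinitelyMany⇒unbounded (BH f positive proper irreducible) a
  in p , pr , inj₂ (inj₂ (ppi , + n , (a , mb , +≤+ a≤n) , fₙ≡p))
  where open PPI ppi

-- `Φ p` attains p at 1, and any other non-constant member attains it at some b no smaller than MB,
-- hence positive.
member⇒prime-value : ∀ {p f} → PPI f → f ∈ 𝓕 p → ∃[ n ] 0 ℕ.< n × eval f (+ n) ≡ + p
member⇒prime-value {p} ppi (inj₁ f≈p) = contradiction f≈p (PPI≉const (+ p) ppi)
member⇒prime-value {p} {f} ppi (inj₂ (inj₁ f≈Φ)) =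
  1 , z<s , trans (eval-cong f (Φ p) f≈Φ 1ℤ) (eval-Φ-1 p)
member⇒prime-value {p} {f} ppi (inj₂ (inj₂ (_ , b , b≥MB , f≡p)))
  with n , refl ← ≥MB⇒positive {f = f} b≥MB = suc n , z<s , f≡p

member⇒BH : (∀ f → PPI f → ∃[ p ] Prime p × f ∈ 𝓕 p) → BouniakowskyHypothesis
member⇒BH member f pos prop irr = unbounded⇒infinitelyMany λ k →
  -- This is f(x + k), so its prime value at a positive `n` is a value of `f` at n + k, beyond `k`.
  let g   = translate f (ℤ.- + k)
      ppi = translate-PPI f (ℤ.- + k) record { positive = pos ; proper = prop ; irreducible = irr }
      p , pr , g∈𝓕 = member g ppi
      n , 0<n , gₙ≡p = member⇒prime-value ppi g∈𝓕
  in n ℕ.+ k , ℕ.m<n+m k 0<n , ℕ.≤-trans 0<n (ℕ.m≤m+n n k) , p , pr ,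
     (begin
       eval f (+ (n ℕ.+ k))               ≡⟨ cong (λ i → eval f (+ n ℤ.+ i)) (ℤ.neg-involutive (+ k)) ⟨
       eval f (+ n ℤ.- ℤ.- + k)           ≡⟨ eval-translate f (ℤ.- + k) (+ n) ⟨
       eval g (+ n)                       ≡⟨ gₙ≡p ⟩
       + p                                ∎)
  where open ≡-Reasoning

theorem8 : (∀ p q → Prime p → Prime q → (𝓕 p ≐ 𝓕 q) ⇔ p ≡ q)
    × (∀ p → Prime p → InfinitelyMany polySetoid λ f →
    PPI f × (∃[ n ] eval f n ≡ + p) × (∀ b → ¬ (translate f b ∈ 𝓕 p)))
    × (BouniakowskyHypothesis ⇔ (∀ f → PPI f → ∃[ p ] Prime p × f ∈ 𝓕 p))
theorem8 =
    (λ p q _ _ → mk⇔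
      -- The constant p lies in `𝓕 p` and hence in `𝓕 q`.
      (λ 𝓕p≐𝓕q → const∈𝓕⇒≡ p q (proj₁ 𝓕p≐𝓕q (inj₁ λ _ → refl)))
      (λ { refl → ≐-refl }))
  , (λ p pr → unbounded-degrees (binomial pr)
      (λ k → binomial-PPI pr k , (0ℤ , eval-binomial-0 pr k) , translate-binomial∉𝓕 pr k)
      -- The leading coefficient 1 sits in degree 2k + 2, which is at least k.
      (λ k → 2 ℕ.+ k ℕ.* 2 , ℕ.≤-trans (ℕ.m≤m*n k 2) (ℕ.m≤n+m (k ℕ.* 2) 2) ,
        λ top≡0 → case trans (sym (coeff-monomial-top (suc (k ℕ.* 2)))) top≡0 of λ ()))
  , mk⇔ BH⇒member member⇒BH
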